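{- Let $H=\prod_p p^{a_p}<H'=\prod_p p^{b_p}$ be consecutive highly composite numbers with $L_-(H,H')=2$. Put $g=\gcd(H,H')$, $\delta=d(g)/d(H)$ and $m=L_+(H,H')$. If the two required deletion layers lie in distinct prime coordinates, let $t$ be the smaller of the two primes; if they lie in one coordinate, let $t$ be that prime. If $$\delta\,G_H(t,m)\le 1,$$ then there is a required insertion with prime base $q\ge t$ (i.e. a prime $q\ge t$ with $b_q>a_q$), and therefore $$\beta^{\mathrm{geo}}(H,H')\ge\frac12.$$
   Context: $d(n)$ denotes the number of positive divisors of $n$. A positive integer $H$ is highly composite if $d(m)<d(H)$ for all integers $1\le m<H$. Two highly composite numbers $H<H'$ are consecutive if no highly composite number lies strictly between them. Put $L_-(H,H')=\sum_p\max(a_p-b_p,0)$ and $L_+(H,H')=\sum_p\max(b_p-a_p,0)$. The required deletion layers are the pairs $(p,j)$ with $b_p<j\le a_p$; the coordinate of $(p,j)$ is $p$. For a prime $t$ and an integer $m\ge0$, the left packing functional is $$G_H(t,m)=\max\ \prod_{q<t}\frac{a_q+x_q+1}{a_q+1},$$ where $q$ runs over the primes less than $t$ and the maximum is over nonnegative integers $(x_q)_{q<t}$ with $\sum_{q<t}x_q=m$; if $t=2$ and $m>0$ the feasible set is empty and $G_H(2,m):=0$. An exponent-lattice geodesic from $H$ to $H'$ is a sequence of positive integers starting at $H$ and ending at $H'$ in which each step changes the exponent of exactly one prime by one unit, always in the direction of its target exponent. It is $H'$-admissible if every vertex $z$ satisfies $z\le H'$. The normalised geodesic capacity is $$\beta^{\mathrm{geo}}(H,H')=\frac{1}{d(H)}\max_{\gamma}\min_{z\in\gamma}d(z),$$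 where $\gamma$ ranges over the $H'$-admissible geodesics from $H$ to $H'$ and $z$ over all vertices of $\gamma$, endpoints included. -}

module Defs where

open import Data.Nat using (ℕ; zero; suc; _+_; _∸_; _^_; _⊔_; _≤_; _<_; NonZero; >-nonZero; z≤n; s≤s)
open import Data.Nat.Properties using (_≟_; _≤?_; _<?_; ≤-trans; ≮⇒≥; <⇒≱; m≤m⊔n; m≤n⊔m; n≤0⇒n≡0; nonZero?; anyUpTo?; allUpTo?)
open import Data.Nat.Divisibility using (_∣_; _∣?_; 1∣_; ∣-trans; ∣⇒≤; m∣m*n)
open import Data.Nat.Primality using (Prime; prime?)
open import Data.Nat.ListAction using (sum)
open import Data.Integer using (+_)
open import Data.Rational using (ℚ; 0ℚ; 1ℚ; _/_) renaming (_*_ to _*ℚ_)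
open import Data.Rational.Properties using () renaming (≤-decTotalOrder to ≤ℚ-decTotalOrder)
open import Data.List using (List; []; _∷_; [_]; length; map; filter; foldr; upTo; zipWith; cartesianProductWith; head; last)
open import Data.List.Properties using (filter-some)
open import Data.List.Extrema.Nat using (max; min; max≤v⁺)
open import Data.List.Membership.Propositional using (_∈_)
open import Data.List.Membership.Propositional.Properties using (∈-filter⁻; ∈-upTo⁻)
open import Data.List.Relation.Unary.All as All using (All)
open import Data.List.Relation.Unary.Any using (here)
open import Data.List.Relation.Unary.Linked using (Linked; linked?)
open import Data.Maybe using (just)
open import Data.Maybe.Properties using (≡-dec)
open import Data.Product using (_×_; _,_; ∃-syntax)
open import Data.Sum using (_⊎_; inj₁; inj₂)
open import Relation.Binary.PropositionalEquality using (_≡_; _≢_; sym; trans)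
open import Relation.Nullary using (¬_; Dec; yes; no; ¬?; contradiction)
open import Relation.Nullary.Decidable using (map′; _×-dec_; _⊎-dec_; _→-dec_)
open import Relation.Binary.Bundles using (DecTotalOrder)
import Data.List.Extrema (DecTotalOrder.totalOrder ≤ℚ-decTotalOrder) as Extremaℚ

d : ℕ → ℕ
d n = length (filter (_∣? n) (map suc (upTo n)))

d-nonZero : ∀ n .{{_ : NonZero n}} → NonZero (d n)
d-nonZero (suc n) = >-nonZero (filter-some (_∣? suc n) (here (1∣ suc n)))

-- The exponent of the prime p in n ≥ 1: the largest k with p ^ k ∣ n.
-- The search is restricted to k ≤ n, which loses nothing since k < p ^ k ≤ n.
v : ℕ → ℕ → ℕ
v p n = max 0 (filter (λ k → p ^ k ∣? n) (upTo (suc n)))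

primesBelow : ℕ → List ℕ
primesBelow n = filter prime? (upTo n)

HighlyComposite : ℕ → Set
HighlyComposite H = NonZero H × (∀ m → 1 ≤ m → m < H → d m < d H)

record Consecutive (H H' : ℕ) : Set where
  field
    highlyComposite  : HighlyComposite H
    highlyComposite′ : HighlyComposite H'
    ordered          : H < H'
    noneBetween      : ∀ K → HighlyComposite K → ¬ (H < K × K < H')

-- Primes beyond H ⊔ H' divide neither number and contribute 0; the truncated
-- subtraction a ∸ b is max (a - b, 0).
L⁻ L⁺ : ℕ → ℕ → ℕ
L⁻ H H' = sum (map (λ p → v p H ∸ v p H') (primesBelow (suc (H ⊔ H'))))
L⁺ H H' = sum (map (λ p → v p H' ∸ v p H) (primesBelow (suc (H ⊔ H'))))

record DeletionLayer (H H' p j : ℕ) : Set where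
  field
    base  : Prime p
    above : v p H' < j
    upto  : j ≤ v p H

-- When L⁻ H H' ≡ 2 there are exactly two deletion layers, and t is determined
-- by them.
data Pivot (H H' : ℕ) : ℕ → Set where
  distinct : ∀ {p j q k} → DeletionLayer H H' p j → DeletionLayer H H' q k → p < q → Pivot H H' p
  single   : ∀ {p j k} → DeletionLayer H H' p j → DeletionLayer H H' p k → j < k → Pivot H H' p

-- All lists of length n with entries taken from xs.
words : ∀ {a} {A : Set a} → ℕ → List A → List (List A)
words zero    xs = [ [] ]
words (suc n) xs = cartesianProductWith _∷_ xs (words n xs)

-- The tuples (x_q), listed along primesBelow t, with sum m; each entry of such
-- a tuple is at most m.
packings : ℕ → ℕ → List (List ℕ)
packings t m = filter (λ x → sum x ≟ m) (words (length (primesBelow t)) (upTo (suc m)))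

packingValue : ℕ → ℕ → List ℕ → ℚ
packingValue H t x = foldr _*ℚ_ 1ℚ (zipWith (λ q x_q → + (v q H + x_q + 1) / suc (v q H)) (primesBelow t) x)

-- All values are positive, so the default 0ℚ matters only when there is no
-- packing, where 0 is the prescribed value.
G : ℕ → ℕ → ℕ → ℚ
G H t m = Extremaℚ.max 0ℚ (map (packingValue H t) (packings t m))

-- An exponent a moves by one unit to a', in the direction of b.
Toward : ℕ → ℕ → ℕ → Set
Toward b a a' = (a < b × a' ≡ suc a) ⊎ (b < a × a ≡ suc a')

Step : ℕ → ℕ → ℕ → Set
Step H' z w = ∃[ p ] Prime p × Toward (v p H') (v p z) (v p w) × (∀ q → Prime q → q ≢ p → v q w ≡ v q z)

record Geodesic (H H' : ℕ) (γ : List ℕ) : Set where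
  field
    start    : head γ ≡ just H
    end      : last γ ≡ just H'
    positive : All NonZero γ
    steps    : Linked (Step H') γ

Admissible : ℕ → List ℕ → Set
Admissible H' γ = All (_≤ H') γ

v-large : ∀ {q n} → n < q → v q n ≡ 0
v-large {q} {n} n<q = n≤0⇒n≡0 (max≤v⁺ {xs = filter (λ k → q ^ k ∣? n) (upTo (suc n))} z≤n (All.tabulate bound))
  where
  small : ∀ n k → n < q → k < suc n → q ^ k ∣ n → k ≤ 0
  small n       zero    _   _         _   = z≤n
  small zero    (suc k) _   (s≤s ())  _
  small (suc n) (suc k) n<q _         q^k = contradiction (∣⇒≤ (∣-trans (m∣m*n (q ^ k)) q^k)) (<⇒≱ n<q)

  bound : ∀ {k} → k ∈ filter (λ k → q ^ k ∣? n) (upTo (suc n)) → k ≤ 0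
  bound {k} k∈ with ∈-filter⁻ (λ k → q ^ k ∣? n) {xs = upTo (suc n)} k∈
  ... | k∈upTo , q^k∣n = small n k n<q (∈-upTo⁻ k∈upTo) q^k∣n

toward? : ∀ b a a' → Dec (Toward b a a')
toward? b a a' = ((a <? b) ×-dec (a' ≟ suc a)) ⊎-dec ((b <? a) ×-dec (a ≟ suc a'))

step? : ∀ H' z w → Dec (Step H' z w)
step? H' z w = map′ to from (anyUpTo? body? B)
  where
  B : ℕ
  B = suc (z ⊔ w)

  Others Body : ℕ → Set
  Others p = ∀ {q} → q < B → Prime q → q ≢ p → v q w ≡ v q z
  Body p = Prime p × Toward (v p H') (v p z) (v p w) × Others p

  body? : ∀ p → Dec (Body p)
  body? p = prime? p ×-dec toward? (v p H') (v p z) (v p w) ×-dec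
    allUpTo? (λ q → prime? q →-dec (¬? (q ≟ p) →-dec (v q w ≟ v q z))) B

  vz≡0 : ∀ {q} → B ≤ q → v q z ≡ 0
  vz≡0 B≤q = v-large (≤-trans (s≤s (m≤m⊔n z w)) B≤q)

  vw≡0 : ∀ {q} → B ≤ q → v q w ≡ 0
  vw≡0 B≤q = v-large (≤-trans (s≤s (m≤n⊔m z w)) B≤q)

  to : (∃[ p ] p < B × Body p) → Step H' z w
  to (p , _ , p-prime , toward , others) = p , p-prime , toward , all
    where
    all : ∀ q → Prime q → q ≢ p → v q w ≡ v q z
    all q q-prime q≢p with q <? B
    ... | yes q<B = others q<B q-prime q≢p
    ... | no  q≮B = trans (vw≡0 (≮⇒≥ q≮B)) (sym (vz≡0 (≮⇒≥ q≮B)))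

  from : Step H' z w → ∃[ p ] p < B × Body p
  from (p , p-prime , toward , others) with p <? B
  ... | yes p<B = p , p<B , p-prime , toward , λ {q} _ → others q
  ... | no  p≮B with toward
  ...   | inj₁ (_ , e) = contradiction (trans (sym (vw≡0 (≮⇒≥ p≮B))) e) λ ()
  ...   | inj₂ (_ , e) = contradiction (trans (sym (vz≡0 (≮⇒≥ p≮B))) e) λ ()

geodesic? : ∀ H H' γ → Dec (Geodesic H H' γ)
geodesic? H H' γ = map′
  (λ (s , e , p , l) → record { start = s ; end = e ; positive = p ; steps = l })
  (λ g → let open Geodesic g in start , end , positive , steps)
  (≡-dec _≟_ (head γ) (just H) ×-dec ≡-dec _≟_ (last γ) (just H') ×-dec
   All.all? nonZero? γ ×-dec linked? (step? H') γ)

-- Each step lowers Σ_p |v p z - v p H'| by exactly one, so every geodesic has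
-- L⁻ + L⁺ steps; the vertices of an admissible one are at most H'. Hence this
-- lists all admissible geodesics.
admissibleGeodesics : ℕ → ℕ → List (List ℕ)
admissibleGeodesics H H' =
  filter (λ γ → geodesic? H H' γ ×-dec All.all? (_≤? H') γ)
    (words (suc (L⁻ H H' + L⁺ H H')) (upTo (suc H')))

-- The value at [] is irrelevant: a geodesic is nonempty.
minDivisors : List ℕ → ℕ
minDivisors []       = 0
minDivisors (z ∷ zs) = min (d z) (map d zs)

-- The default 0 is never the maximum: for positive H < H', deleting all the
-- deletion layers and then inserting gives an admissible geodesic.
βgeo : (H H' : ℕ) .{{_ : NonZero H}} → ℚ
βgeo H H' = (+ max 0 (map minDivisors (admissibleGeodesics H H')) / d H) {{d-nonZero H}}

{-# OPTIONS --safe #-}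
module Submission where

open import Defs
open import Algebra.Structures using (IsCommutativeMonoid)
open import Data.Nat using (ℕ; zero; suc; _+_; _*_; _^_; _∸_; _⊓_; _⊔_; _≤_; _<_; NonZero; ≢-nonZero; ≢-nonZero⁻¹; >-nonZero⁻¹; z≤n; s≤s; nonTrivial⇒n>1)
open import Data.Nat.Properties
open import Algebra.Properties.CommutativeSemigroup *-commutativeSemigroup using (xy∙z≈y∙xz; x∙yz≈z∙xy; xy∙z≈xz∙y)
open import Data.Nat.GCD using (gcd; gcd[m,n]∣m; gcd[m,n]∣n; gcd-greatest; gcd[m,n]≢0)
open import Data.Nat.Divisibility
open import Data.Nat.Primality using (Prime; prime⇒nonZero; prime⇒nonTrivial; prime⇒irreducible; euclidsLemma; ¬prime[1]; prime?)
open import Data.Nat.Primality.Factorisation using (PrimeFactorisation; factorise)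
open import Data.Nat.ListAction using (sum; product)
open import Data.Nat.ListAction.Properties using (∈⇒∣product; product≢0)
open import Data.Nat.Tactic.RingSolver using (solve-∀)
open import Data.Integer using (+_)
import Data.Integer as ℤ
import Data.Integer.Properties as ℤ
open import Data.Rational using (0ℚ; 1ℚ; ½; _/_; toℚᵘ) renaming (_*_ to _*ℚ_; _≤_ to _≤ℚ_)
import Data.Rational.Properties as ℚ
open import Data.Rational.Unnormalised as ℚᵘ using (mkℚᵘ; *≤*)
import Data.Rational.Unnormalised.Properties as ℚᵘ
open import Data.List using (List; []; _∷_; _++_; length; map; filter; foldl; foldr; upTo; zipWith)
open import Data.List.Properties using (length-++; length-map; map-cong-local)
open import Data.List.Extrema.Nat using (max; argmax-all; argmin-all; xs≤max)
open import Data.List.Membership.Propositional using (_∈_; _∉_)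
open import Data.List.Membership.Propositional.Properties using (∈-filter⁻; ∈-filter⁺; ∈-upTo⁻; ∈-upTo⁺; ∈-map⁺; ∈-map⁻; ∈-++⁺ˡ; ∈-++⁺ʳ; ∈-++⁻; ∈-cartesianProductWith⁺)
open import Data.List.Membership.Propositional.Properties.WithK using (unique∧set⇒bag)
open import Data.List.Membership.DecPropositional _≟_ using (_∈?_)
open import Data.List.Relation.Binary.BagAndSetEquality using (∼bag⇒↭)
open import Data.List.Relation.Binary.Permutation.Propositional.Properties using (↭-length)
open import Data.List.Relation.Unary.All as All using (All; []; _∷_)
import Data.List.Relation.Unary.All.Properties as All
open import Data.List.Relation.Unary.AllPairs using ([]; _∷_)
open import Data.List.Relation.Unary.Any using (here; there)
open import Data.List.Relation.Unary.Linked using ([-]; _∷_)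
open import Data.List.Relation.Unary.Unique.Propositional using (Unique)
import Data.List.Relation.Unary.Unique.Propositional.Properties as Unique
open import Data.Maybe.Properties using (just-injective)
open import Data.Product using (_×_; _,_; ∃-syntax; proj₁; proj₂)
open import Data.Sum using (_⊎_; inj₁; inj₂; [_,_]′)
open import Function using (_∘_; id; mk⇔)
open import Relation.Binary.Bundles using (DecTotalOrder)
open import Relation.Binary.PropositionalEquality using (_≡_; _≢_; refl; sym; trans; cong; cong₂; subst; subst₂; module ≡-Reasoning)
open import Relation.Nullary using (¬_; Dec; yes; no; contradiction)
open import Relation.Nullary.Decidable using (_×-dec_)
import Data.List.Extrema (DecTotalOrder.totalOrder ℚ.≤-decTotalOrder) as Extremaℚ

-- Write g = gcd(H, H'), H = g t s with primes t ≤ s, and H' = g r₁ ⋯ r_m with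
-- primes rᵢ. If all rᵢ were below t, their multiplicities would be a feasible
-- packing of value d(H')/d(g), so d(H') ≤ d(g) G ≤ d(H), which is impossible.
-- Hence some rᵢ, say q, satisfies q ≥ t, and q ≠ t since t is deleted. The
-- geodesic which deletes s, inserts every rᵢ except q, deletes t and finally
-- inserts q stays below H' because its largest intermediate vertex is H' t/q.
-- Each of its vertices other than H and H' is H'/q or a multiple of H/s, and
-- dividing by one prime at most halves d.

-- Exponents

prime>1 : ∀ {p} → Prime p → 1 < p
prime>1 {p} pp = nonTrivial⇒n>1 p {{prime⇒nonTrivial pp}}

prime∣prime⇒≡ : ∀ {p q} → Prime p → Prime q → p ∣ q → p ≡ q
prime∣prime⇒≡ pp pq p∣q with prime⇒irreducible pq p∣q
... | inj₁ refl = contradiction pp ¬prime[1]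
... | inj₂ p≡q  = p≡q

n<p^n : ∀ {p} → 1 < p → ∀ n → n < p ^ n
n<p^n     1<p zero    = s≤s z≤n
n<p^n {p} 1<p (suc n) = ≤-trans (s≤s (n<p^n 1<p n)) (^-monoʳ-< p 1<p (n<1+n n))

^-monoʳ-∣ : ∀ p {k l} → k ≤ l → p ^ k ∣ p ^ l
^-monoʳ-∣ p z≤n       = 1∣ _
^-monoʳ-∣ p (s≤s k≤l) = *-monoʳ-∣ p (^-monoʳ-∣ p k≤l)

p^v∣n : ∀ p n → p ^ v p n ∣ n
p^v∣n p n = argmax-all id {P = λ k → p ^ k ∣ n} (1∣ n) (All.all-filter (λ k → p ^ k ∣? n) (upTo (suc n)))

-- Since k < p ^ k ≤ n, the exponent k lies in the range that `v` searches.
p^k∣n⇒k≤v : ∀ {p} → Prime p → ∀ n .{{_ : NonZero n}} k → p ^ k ∣ n → k ≤ v p n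
p^k∣n⇒k≤v {p} pp n k p^k∣n = All.lookup (xs≤max 0 _)
  (∈-filter⁺ (λ k → p ^ k ∣? n) (∈-upTo⁺ (m≤n⇒m≤1+n (≤-trans (n<p^n (prime>1 pp) k) (∣⇒≤ p^k∣n)))) p^k∣n)

v-mono-∣ : ∀ {p} → Prime p → ∀ m n .{{_ : NonZero n}} → m ∣ n → v p m ≤ v p n
v-mono-∣ {p} pp m n m∣n = p^k∣n⇒k≤v pp n (v p m) (∣-trans (p^v∣n p m) m∣n)

v-*-same : ∀ {p} → Prime p → ∀ n .{{_ : NonZero n}} → v p (n * p) ≡ suc (v p n)
v-*-same {p} pp n = ≤-antisym (upper (v p (n * p)) (p^v∣n p (n * p)))
  (p^k∣n⇒k≤v pp (n * p) (suc (v p n)) (subst (_∣ n * p) (*-comm (p ^ v p n) p) (*-monoˡ-∣ p (p^v∣n p n))))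
  where
  instance
    _ = prime⇒nonZero pp
    _ = m*n≢0 n p
  upper : ∀ k → p ^ k ∣ n * p → k ≤ suc (v p n)
  upper zero    _ = z≤n
  upper (suc k) h = s≤s (p^k∣n⇒k≤v pp n k (*-cancelˡ-∣ p (subst (p * p ^ k ∣_) (*-comm n p) h)))

-- Induction on k: by Euclid's lemma q divides n, as it cannot divide the other prime p, and one
-- factor q is cancelled on both sides.
q^k∣n*p⇒q^k∣n : ∀ {p q} → Prime p → Prime q → q ≢ p → ∀ k n → q ^ k ∣ n * p → q ^ k ∣ n
q^k∣n*p⇒q^k∣n         pp pq q≢p zero    n h = 1∣ n
q^k∣n*p⇒q^k∣n {p} {q} pp pq q≢p (suc k) n h with euclidsLemma n p pq (m*n∣⇒m∣ q (q ^ k) h)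
... | inj₂ q∣p = contradiction (prime∣prime⇒≡ pq pp q∣p) q≢p
... | inj₁ (divides n′ refl) = subst (q * q ^ k ∣_) (*-comm q n′) (*-monoʳ-∣ q (q^k∣n*p⇒q^k∣n pp pq q≢p k n′
        (*-cancelˡ-∣ q (subst (q * q ^ k ∣_) (xy∙z≈y∙xz n′ q p) h))))
  where
  instance _ = prime⇒nonZero pq

v-*-other : ∀ {p q} → Prime p → Prime q → q ≢ p → ∀ n .{{_ : NonZero n}} → v q (n * p) ≡ v q n
v-*-other {p} {q} pp pq q≢p n = ≤-antisym
  (p^k∣n⇒k≤v pq n (v q (n * p)) (q^k∣n*p⇒q^k∣n pp pq q≢p (v q (n * p)) n (p^v∣n q (n * p))))
  (v-mono-∣ pq n (n * p) (m∣m*n p))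
  where
  instance
    _ = prime⇒nonZero pp
    _ = m*n≢0 n p

-- The divisor function

divisors : ℕ → List ℕ
divisors n = filter (_∣? n) (map suc (upTo n))

divisors-unique : ∀ n → Unique (divisors n)
divisors-unique n = Unique.filter⁺ (_∣? n) (Unique.map⁺ suc-injective (Unique.upTo⁺ n))

∈-divisors⁻ : ∀ {n x} → x ∈ divisors n → x ∣ n
∈-divisors⁻ {n} x∈ = proj₂ (∈-filter⁻ (_∣? n) {xs = map suc (upTo n)} x∈)

∈-divisors⁺ : ∀ n .{{_ : NonZero n}} {x} → x ∣ n → x ∈ divisors n
∈-divisors⁺ (suc n) {zero}  x∣n = contradiction (0∣⇒≡0 x∣n) λ ()
∈-divisors⁺ (suc n) {suc x} x∣n = ∈-filter⁺ (_∣? suc n) (∈-map⁺ suc (∈-upTo⁺ (∣⇒≤ x∣n))) x∣n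

-- Divisors are counted by this bijection principle: duplicate-free lists with the same members are
-- permutations of each other.
length-unique : ∀ {a} {A : Set a} {xs ys : List A} → Unique xs → Unique ys →
  (∀ {x} → x ∈ xs → x ∈ ys) → (∀ {x} → x ∈ ys → x ∈ xs) → length xs ≡ length ys
length-unique xs! ys! to from = ↭-length (∼bag⇒↭ (unique∧set⇒bag xs! ys! (mk⇔ to from)))

-- Let c be the cofactor of x. By Euclid's lemma p divides c or x. In the first case p cancels and x
-- divides p ^ a * k. In the second, x = x′ * p with x′ ∣ p ^ a * k, and the argument recurs on a.
∣p*n-split : ∀ {p} → Prime p → ∀ a k {x} → x ∣ p ^ suc a * k →
  x ∣ p ^ a * k ⊎ ∃[ y ] x ≡ p ^ suc a * y × y ∣ k
∣p*n-split {p} pp a k {x} (divides c eq) with euclidsLemma c x pp (divides (p ^ a * k) (trans (sym eq) (trans (*-assoc p (p ^ a) k) (*-comm p _))))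
... | inj₁ (divides c′ refl) = inj₁ (divides c′ (*-cancelˡ-≡ _ _ p {{prime⇒nonZero pp}}
        (trans (sym (*-assoc p (p ^ a) k)) (trans eq (xy∙z≈y∙xz c′ p x)))))
... | inj₂ (divides x′ refl) = descend a (divides c (*-cancelˡ-≡ _ _ p {{prime⇒nonZero pp}}
        (trans (sym (*-assoc p (p ^ a) k)) (trans eq (x∙yz≈z∙xy c x′ p)))))
  where
  descend : ∀ a → x′ ∣ p ^ a * k → x′ * p ∣ p ^ a * k ⊎ ∃[ y ] x′ * p ≡ p ^ suc a * y × y ∣ k
  descend zero    x′∣ = inj₂ (x′ , trans (*-comm x′ p) (cong (_* x′) (sym (*-identityʳ p))) , subst (x′ ∣_) (*-identityˡ k) x′∣)
  descend (suc a) x′∣ with ∣p*n-split pp a k x′∣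
  ... | inj₁ h = inj₁ (subst₂ _∣_ (*-comm p x′) (sym (*-assoc p (p ^ a) k)) (*-monoʳ-∣ p h))
  ... | inj₂ (y , refl , y∣k) = inj₂ (y , trans (*-comm (p * p ^ a * y) p) (sym (*-assoc p (p * p ^ a) y)) , y∣k)

-- The new divisors are the p ^ suc a * y with y ∣ k. None of them divides p ^ a * k, since
-- cancelling p ^ a would give p ∣ k.
d-p^-suc : ∀ {p} → Prime p → ∀ {k} .{{_ : NonZero k}} → p ∤ k → ∀ a → d (p ^ suc a * k) ≡ d (p ^ a * k) + d k
d-p^-suc {p} pp {k} p∤k a = trans
  (length-unique (divisors-unique n′) (Unique.++⁺ (divisors-unique n) (Unique.map⁺ (*-cancelˡ-≡ _ _ P) (divisors-unique k)) disjoint) to from)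
  (trans (length-++ (divisors n)) (cong (λ z → d n + z) (length-map (P *_) (divisors k))))
  where
  P = p ^ suc a
  n = p ^ a * k
  n′ = P * k
  instance
    p≢0 = prime⇒nonZero pp
    _ = m^n≢0 p a
    _ = m^n≢0 p (suc a)
    _ = m*n≢0 (p ^ a) k
    _ = m*n≢0 P k
  disjoint : ∀ {x} → ¬ (x ∈ divisors n × x ∈ map (P *_) (divisors k))
  disjoint (x∈ , x∈′) with ∈-map⁻ (P *_) x∈′
  ... | y , _ , refl = p∤k (*-cancelˡ-∣ (p ^ a) (subst (_∣ n) (*-comm p (p ^ a)) (m*n∣⇒m∣ P y (∈-divisors⁻ {n} x∈))))
  to : ∀ {x} → x ∈ divisors n′ → x ∈ divisors n ++ map (P *_) (divisors k)
  to x∈ with ∣p*n-split pp a k (∈-divisors⁻ {n′} x∈)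
  ... | inj₁ x∣n = ∈-++⁺ˡ (∈-divisors⁺ n x∣n)
  ... | inj₂ (y , refl , y∣k) = ∈-++⁺ʳ (divisors n) (∈-map⁺ (P *_) (∈-divisors⁺ k y∣k))
  from : ∀ {x} → x ∈ divisors n ++ map (P *_) (divisors k) → x ∈ divisors n′
  from x∈ with ∈-++⁻ (divisors n) x∈
  ... | inj₁ x∈n = ∈-divisors⁺ n′ (∣-trans (∈-divisors⁻ {n} x∈n) (*-monoˡ-∣ k (n∣m*n p)))
  ... | inj₂ x∈k with ∈-map⁻ (P *_) x∈k
  ...   | y , y∈ , refl = ∈-divisors⁺ n′ (*-monoʳ-∣ P (∈-divisors⁻ {k} y∈))

d-p^ : ∀ {p} → Prime p → ∀ {k} .{{_ : NonZero k}} → p ∤ k → ∀ a → d (p ^ a * k) ≡ suc a * d k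
d-p^ pp {k} p∤k zero    = trans (cong d (*-identityˡ k)) (sym (*-identityˡ (d k)))
d-p^ pp {k} p∤k (suc a) = trans (d-p^-suc pp p∤k a) (trans (cong (_+ d k) (d-p^ pp p∤k a)) (+-comm _ (d k)))

-- With a = v p n this is d (n * p) / d n = (a + 2) / (a + 1), cross-multiplied to stay in ℕ. It
-- follows from n = p ^ a * k with p ∤ k.
d-*-prime : ∀ {p} → Prime p → ∀ n .{{_ : NonZero n}} → d n * suc (suc (v p n)) ≡ d (n * p) * suc (v p n)
d-*-prime {p} pp n with p^v∣n p n
... | divides k n≡ = trans (cong (_* suc (suc a)) d≡) (trans (rearrange a (d k)) (cong (_* suc a) (sym d′≡)))
  where
  a = v p n
  n≡′ : n ≡ p ^ a * k
  n≡′ = trans n≡ (*-comm k (p ^ a))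
  rearrange : ∀ a x → suc a * x * suc (suc a) ≡ suc (suc a) * x * suc a
  rearrange = solve-∀
  instance
    _ : NonZero (p ^ a * k)
    _ = ≢-nonZero (λ e → ≢-nonZero⁻¹ n (trans n≡′ e))
    _ : NonZero k
    _ = m*n≢0⇒n≢0 (p ^ a) {k}
  p∤k : p ∤ k
  p∤k (divides c refl) = 1+n≰n (p^k∣n⇒k≤v pp n (suc a) (divides c (trans n≡ (*-assoc c p (p ^ a)))))
  d≡ : d n ≡ suc a * d k
  d≡ = trans (cong d n≡′) (d-p^ pp p∤k a)
  d′≡ : d (n * p) ≡ suc (suc a) * d k
  d′≡ = trans (cong d (trans (*-comm n p) (trans (cong (p *_) n≡′) (sym (*-assoc p (p ^ a) k))))) (d-p^ pp p∤k (suc a))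

-- Products of primes

module FoldUpdate {_∙_ : ℕ → ℕ → ℕ} {ε : ℕ} (isCM : IsCommutativeMonoid _≡_ _∙_ ε) where
  open IsCommutativeMonoid isCM using (assoc; comm)

  -- The folds differ only in the entry at p, which occurs once; crossing it over avoids subtraction
  -- and division. The instance for + serves sums of exponents, the one for * serves divisor counts.
  fold-update : ∀ {f f′ : ℕ → ℕ} {p xs} → Unique xs → p ∈ xs → (∀ {q} → q ∈ xs → q ≢ p → f′ q ≡ f q) →
    foldr _∙_ ε (map f′ xs) ∙ f p ≡ foldr _∙_ ε (map f xs) ∙ f′ p
  fold-update {f} {f′} {xs = x ∷ xs} (x∉ ∷ xs!) (here refl) same = begin
    (f′ x ∙ foldr _∙_ ε (map f′ xs)) ∙ f x ≡⟨ cong (λ z → (f′ x ∙ foldr _∙_ ε z) ∙ f x)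
      (map-cong-local (All.tabulate λ q∈ → same (there q∈) (All.lookup x∉ q∈ ∘ sym))) ⟩
    (f′ x ∙ F) ∙ f x ≡⟨ comm _ _ ⟩
    f x ∙ (f′ x ∙ F) ≡⟨ cong (f x ∙_) (comm _ _) ⟩
    f x ∙ (F ∙ f′ x) ≡⟨ assoc _ _ _ ⟨
    (f x ∙ F) ∙ f′ x ∎
    where
    open ≡-Reasoning
    F = foldr _∙_ ε (map f xs)
  fold-update {f} {f′} {p} {x ∷ xs} (x∉ ∷ xs!) (there p∈) same = begin
    (f′ x ∙ F′) ∙ f p ≡⟨ assoc _ _ _ ⟩
    f′ x ∙ (F′ ∙ f p) ≡⟨ cong₂ _∙_ (same (here refl) (All.lookup x∉ p∈)) (fold-update xs! p∈ (same ∘ there)) ⟩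
    f x ∙ (F ∙ f′ p) ≡⟨ assoc _ _ _ ⟨
    (f x ∙ F) ∙ f′ p ∎
    where
    open ≡-Reasoning
    F = foldr _∙_ ε (map f xs)
    F′ = foldr _∙_ ε (map f′ xs)

open FoldUpdate +-0-isCommutativeMonoid renaming (fold-update to sum-update)
open FoldUpdate *-1-isCommutativeMonoid renaming (fold-update to product-update)

infixl 7 _⊛_
-- A left fold makes n ⊛ (p ∷ ps) definitionally (n * p) ⊛ ps, so inductions move one prime at a
-- time into n, and g ⊛ (t ∷ s ∷ []) is g * t * s.
_⊛_ : ℕ → List ℕ → ℕ
_⊛_ = foldl _*_

⊛-product : ∀ n ps → n ⊛ ps ≡ n * product ps
⊛-product n []       = sym (*-identityʳ n)
⊛-product n (p ∷ ps) = trans (⊛-product (n * p) ps) (*-assoc n p (product ps))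

⊛-*-comm : ∀ n p ps → (n * p) ⊛ ps ≡ (n ⊛ ps) * p
⊛-*-comm n p []       = refl
⊛-*-comm n p (r ∷ ps) = trans (cong (_⊛ ps) (xy∙z≈xz∙y n p r)) (⊛-*-comm (n * r) p ps)

∣⇒≡⊛ : ∀ {m n} .{{_ : NonZero n}} → m ∣ n → ∃[ ps ] All Prime ps × n ≡ m ⊛ ps
∣⇒≡⊛ {m} {n} m∣n@(divides c n≡) = ps , PrimeFactorisation.factorsPrime F ,
  trans n≡ (trans (*-comm c m) (trans (cong (m *_) (PrimeFactorisation.isFactorisation F)) (sym (⊛-product m ps))))
  where
  F = factorise c {{quotient≢0 m∣n}}
  ps = PrimeFactorisation.factors F

n*p≢0 : ∀ n .{{_ : NonZero n}} {p} → Prime p → NonZero (n * p)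
n*p≢0 n {p} pp = m*n≢0 n p
  where instance _ = prime⇒nonZero pp

⊛≢0 : ∀ n .{{_ : NonZero n}} {ps} → All Prime ps → NonZero (n ⊛ ps)
⊛≢0 (suc n) []                  = _
⊛≢0 n       {p ∷ ps} (pp ∷ pps) = ⊛≢0 (n * p) {{n*p≢0 n pp}} pps

n∣n⊛ : ∀ n ps → n ∣ n ⊛ ps
n∣n⊛ n ps = subst (n ∣_) (sym (⊛-product n ps)) (m∣m*n (product ps))

n*p∣n⊛ : ∀ n {p ps} → p ∈ ps → n * p ∣ n ⊛ ps
n*p∣n⊛ n {p} {ps} p∈ = subst (n * p ∣_) (sym (⊛-product n ps)) (*-monoʳ-∣ n (∈⇒∣product p∈))

v-⊛-∉ : ∀ {q} → Prime q → ∀ n .{{_ : NonZero n}} {ps} → All Prime ps → q ∉ ps → v q (n ⊛ ps) ≡ v q n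
v-⊛-∉ pq n []                  q∉ = refl
v-⊛-∉ pq n {p ∷ ps} (pp ∷ pps) q∉ = trans
  (v-⊛-∉ pq (n * p) {{n*p≢0 n pp}} pps (q∉ ∘ there))
  (v-*-other pp pq (q∉ ∘ here) n)

v-⊛-∈ : ∀ n .{{_ : NonZero n}} {p ps} → All Prime ps → p ∈ ps → v p n < v p (n ⊛ ps)
v-⊛-∈ n {p} {ps} pps p∈ = subst (_≤ v p (n ⊛ ps)) (v-*-same pp n) (v-mono-∣ pp (n * p) (n ⊛ ps) {{⊛≢0 n pps}} (n*p∣n⊛ n p∈))
  where pp = All.lookup pps p∈

v-⊛-<⇒∈ : ∀ {q} → Prime q → ∀ n .{{_ : NonZero n}} {ps} → All Prime ps → v q n < v q (n ⊛ ps) → q ∈ ps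
v-⊛-<⇒∈ {q} pq n {ps} pps lt with q ∈? ps
... | yes q∈ = q∈
... | no  q∉ = contradiction (sym (v-⊛-∉ pq n pps q∉)) (<⇒≢ lt)

v-gcd : ∀ {p} → Prime p → ∀ m n .{{_ : NonZero m}} .{{_ : NonZero n}} .{{_ : NonZero (gcd m n)}} → v p (gcd m n) ≡ v p m ⊓ v p n
v-gcd {p} pp m n = ≤-antisym
  (⊓-glb (v-mono-∣ pp (gcd m n) m (gcd[m,n]∣m m n)) (v-mono-∣ pp (gcd m n) n (gcd[m,n]∣n m n)))
  (p^k∣n⇒k≤v pp (gcd m n) (v p m ⊓ v p n) (gcd-greatest
    (∣-trans (^-monoʳ-∣ p (m⊓n≤m (v p m) (v p n))) (p^v∣n p m))
    (∣-trans (^-monoʳ-∣ p (m⊓n≤n (v p m) (v p n))) (p^v∣n p n))))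

-- Multiplying by an entry of `ps` raises exactly one exponent by one, and `qs` lists that prime
-- exactly once.
sum-v-⊛ : ∀ {qs} → Unique qs → All Prime qs → ∀ n .{{_ : NonZero n}} {ps} → All (_∈ qs) ps →
  sum (map (λ q → v q (n ⊛ ps)) qs) ≡ sum (map (λ q → v q n) qs) + length ps
sum-v-⊛      qs! pqs n []                 = sym (+-identityʳ _)
sum-v-⊛ {qs} qs! pqs n {p ∷ ps} (p∈ ∷ ps∈) = begin
  sum (map (λ q → v q (n * p ⊛ ps)) qs)              ≡⟨ sum-v-⊛ qs! pqs (n * p) {{n*p≢0 n pp}} ps∈ ⟩
  sum (map (λ q → v q (n * p)) qs) + length ps       ≡⟨ cong (_+ length ps) step ⟩
  suc (sum (map (λ q → v q n) qs)) + length ps       ≡⟨ +-suc _ (length ps) ⟨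
  sum (map (λ q → v q n) qs) + suc (length ps)       ∎
  where
  open ≡-Reasoning
  pp = All.lookup pqs p∈
  step : sum (map (λ q → v q (n * p)) qs) ≡ suc (sum (map (λ q → v q n) qs))
  step = +-cancelʳ-≡ (v p n) _ _ (trans
    (sum-update {f = λ q → v q n} {f′ = λ q → v q (n * p)} qs! p∈ (λ q∈ q≢p → v-*-other pp (All.lookup pqs q∈) q≢p n))
    (trans (cong (λ z → sum (map (λ q → v q n) qs) + z) (v-*-same pp n)) (+-suc _ (v p n))))

sum-⊓+∸ : ∀ {f g h : ℕ → ℕ} {xs} → All (λ x → h x ≡ g x ⊓ f x) xs →
  sum (map h xs) + sum (map (λ x → f x ∸ g x) xs) ≡ sum (map f xs)
sum-⊓+∸ [] = refl
sum-⊓+∸ {f} {g} {h} {x ∷ xs} (hx ∷ hxs) = trans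
  (rearrange (h x) (sum (map h xs)) (f x ∸ g x) _)
  (cong₂ _+_ (trans (cong (_+ (f x ∸ g x)) hx) (m⊓n+n∸m≡n (g x) (f x))) (sum-⊓+∸ hxs))
  where
  rearrange : ∀ a b c e → (a + b) + (c + e) ≡ (a + c) + (b + e)
  rearrange = solve-∀

-- Minimum and excess add up to the exponent of g ⊛ ps, so the total excess is the growth of the
-- exponent sum from g to g ⊛ ps. Taking y = H counts insertions, y = H′ deletions.
sum-v-∸ : ∀ {qs} → Unique qs → All Prime qs → ∀ g .{{_ : NonZero g}} {ps} → All (_∈ qs) ps →
  ∀ y → (∀ {q} → Prime q → v q g ≡ v q y ⊓ v q (g ⊛ ps)) →
  sum (map (λ q → v q (g ⊛ ps) ∸ v q y) qs) ≡ length ps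
sum-v-∸ {qs} qs! pqs g {ps} ps∈ y v-g = +-cancelˡ-≡ (sum (map (λ q → v q g) qs)) _ _
  (trans (sum-⊓+∸ {f = λ q → v q (g ⊛ ps)} {g = λ q → v q y} {h = λ q → v q g} (All.map v-g pqs)) (sum-v-⊛ qs! pqs g ps∈))

-- This is the quotient d (n ⊛ ps) / d n as a product of exponent ratios, obtained by iterating
-- `d-*-prime`. Primes outside `ps` have ratio 1, so any `qs` that covers `ps` serves.
d-⊛ : ∀ {qs} → Unique qs → All Prime qs → ∀ n .{{_ : NonZero n}} {ps} → All (_∈ qs) ps →
  d (n ⊛ ps) * product (map (λ q → suc (v q n)) qs) ≡ d n * product (map (λ q → suc (v q (n ⊛ ps))) qs)
d-⊛      qs! pqs n []                 = refl
-- The extra factor v p n + 2 occurs both in `product-update` and in `d-*-prime`, and is cancelled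
-- at the end.
d-⊛ {qs} qs! pqs n {p ∷ ps} (p∈ ∷ ps∈) = *-cancelʳ-≡ _ _ (suc (suc (v p n))) (begin
  dF * Π * suc (suc (v p n))                           ≡⟨ *-assoc dF Π _ ⟩
  dF * (Π * suc (suc (v p n)))                         ≡⟨ cong (λ z → dF * (Π * suc z)) (v-*-same pp n) ⟨
  dF * (Π * suc (v p (n * p)))                         ≡⟨ cong (dF *_) (product-update
    {f = λ q → suc (v q n)} {f′ = λ q → suc (v q (n * p))} qs! p∈ (λ q∈ q≢p → cong suc (v-*-other pp (All.lookup pqs q∈) q≢p n))) ⟨
  dF * (Π′ * suc (v p n))                              ≡⟨ *-assoc dF Π′ _ ⟨
  dF * Π′ * suc (v p n)                                ≡⟨ cong (_* suc (v p n)) (d-⊛ qs! pqs (n * p) {{n*p≢0 n pp}} ps∈) ⟩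
  d (n * p) * ΠF * suc (v p n)                         ≡⟨ xy∙z≈xz∙y (d (n * p)) ΠF _ ⟩
  d (n * p) * suc (v p n) * ΠF                         ≡⟨ cong (_* ΠF) (d-*-prime pp n) ⟨
  d n * suc (suc (v p n)) * ΠF                         ≡⟨ xy∙z≈xz∙y (d n) _ ΠF ⟩
  d n * ΠF * suc (suc (v p n))                         ∎)
  where
  open ≡-Reasoning
  pp = All.lookup pqs p∈
  dF = d (n * p ⊛ ps)
  Π = product (map (λ q → suc (v q n)) qs)
  Π′ = product (map (λ q → suc (v q (n * p))) qs)
  ΠF = product (map (λ q → suc (v q (n * p ⊛ ps))) qs)

primesBelow-unique : ∀ n → Unique (primesBelow n)
primesBelow-unique n = Unique.filter⁺ prime? (Unique.upTo⁺ n)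

primesBelow-prime : ∀ n → All Prime (primesBelow n)
primesBelow-prime n = All.tabulate (λ q∈ → proj₂ (∈-filter⁻ prime? {xs = upTo n} q∈))

∈-primesBelow⁻ : ∀ {n q} → q ∈ primesBelow n → q < n
∈-primesBelow⁻ {n} q∈ = ∈-upTo⁻ (proj₁ (∈-filter⁻ prime? {xs = upTo n} q∈))

∈-primesBelow⁺ : ∀ {n q} → Prime q → q < n → q ∈ primesBelow n
∈-primesBelow⁺ pq q<n = ∈-filter⁺ prime? (∈-upTo⁺ q<n) pq

-- Packings

toℚᵘ-/ : ∀ a b → toℚᵘ (+ a / suc b) ℚᵘ.≃ mkℚᵘ (+ a) b
toℚᵘ-/ a b = ℚ.toℚᵘ-fromℚᵘ (mkℚᵘ (+ a) b)

-- Fractions in ℚ are normalised, so the identity is checked on unnormalised representatives.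
/-*-/ : ∀ a b c e .{{_ : NonZero b}} .{{_ : NonZero e}} .{{_ : NonZero (b * e)}} →
  (+ a / b) *ℚ (+ c / e) ≡ + (a * c) / (b * e)
/-*-/ a b@(suc b-1) c e@(suc e-1) = ℚ.toℚᵘ-injective (ℚᵘ.≃-trans (ℚ.toℚᵘ-homo-* (+ a / b) (+ c / e))
  (ℚᵘ.≃-trans (ℚᵘ.*-cong (toℚᵘ-/ a b-1) (toℚᵘ-/ c e-1))
  (ℚᵘ.≃-trans (ℚᵘ.≃-reflexive (cong (λ z → mkℚᵘ z (e-1 + b-1 * e)) (sym (ℤ.pos-* a c)))) (ℚᵘ.≃-sym (toℚᵘ-/ (a * c) (e-1 + b-1 * e))))))

/≤1⇒≤ : ∀ a b .{{_ : NonZero b}} → + a / b ≤ℚ 1ℚ → a ≤ b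
/≤1⇒≤ a b@(suc b-1) h with ℚᵘ.≤-respˡ-≃ (toℚᵘ-/ a b-1) (ℚ.toℚᵘ-mono-≤ h)
... | *≤* le = ℤ.drop‿+≤+ (subst₂ ℤ._≤_ (ℤ.*-identityʳ (+ a)) (ℤ.*-identityˡ (+ b)) le)

≤2*⇒½≤/ : ∀ a b .{{_ : NonZero b}} → b ≤ 2 * a → ½ ≤ℚ + a / b
≤2*⇒½≤/ a b@(suc b-1) h = ℚ.toℚᵘ-cancel-≤ (ℚᵘ.≤-respʳ-≃ (ℚᵘ.≃-sym (toℚᵘ-/ a b-1))
  (*≤* (subst₂ ℤ._≤_ (sym (ℤ.*-identityˡ (+ b))) (trans (cong +_ (*-comm 2 a)) (ℤ.pos-* a 2)) (ℤ.+≤+ h))))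

-- Clears denominators in δ G ≤ 1: a / b is δ, and x = c / e is the value of one packing, bounded by
-- y = G.
/*≤1⇒*≤* : ∀ a b c e .{{_ : NonZero b}} .{{_ : NonZero e}} {x y} →
  x ≡ + c / e → x ≤ℚ y → (+ a / b) *ℚ y ≤ℚ 1ℚ → a * c ≤ b * e
/*≤1⇒*≤* a b c e {x} refl x≤y ab*y≤1 = /≤1⇒≤ (a * c) (b * e)
  (subst (_≤ℚ 1ℚ) (/-*-/ a b c e) (ℚ.≤-trans (ℚ.*-monoˡ-≤-nonNeg (+ a / b) x≤y) ab*y≤1))
  where
  instance
    _ = ℚ.normalize-nonNeg a b
    _ = m*n≢0 b e

product-suc≢0 : ∀ (f : ℕ → ℕ) qs → NonZero (product (map (suc ∘ f) qs))
product-suc≢0 f qs = product≢0 (All.map⁺ (All.universal (λ _ → _) qs))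

foldr-*-/ : ∀ (a x : ℕ → ℕ) qs →
  foldr _*ℚ_ 1ℚ (zipWith (λ q x_q → + (a q + x_q + 1) / suc (a q)) qs (map x qs))
    ≡ (+ product (map (λ q → a q + x q + 1) qs) / product (map (suc ∘ a) qs)) {{product-suc≢0 a qs}}
foldr-*-/ a x []       = refl
foldr-*-/ a x (q ∷ qs) = trans (cong ((+ (a q + x q + 1) / suc (a q)) *ℚ_) (foldr-*-/ a x qs))
  (/-*-/ (a q + x q + 1) (suc (a q)) (product (map (λ q → a q + x q + 1) qs)) (product (map (suc ∘ a) qs))
    {{_}} {{product-suc≢0 a qs}} {{product-suc≢0 a (q ∷ qs)}})

∈-words : ∀ {a} {A : Set a} {xs w : List A} → All (_∈ xs) w → w ∈ words (length w) xs
∈-words []        = here refl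
∈-words (x∈ ∷ w∈) = ∈-cartesianProductWith⁺ _∷_ x∈ (∈-words w∈)

all≤sum : ∀ xs → All (_≤ sum xs) xs
all≤sum []       = []
all≤sum (x ∷ xs) = m≤m+n x (sum xs) ∷ All.map (λ le → ≤-trans le (m≤n+m (sum xs) x)) (all≤sum xs)

-- Each entry of the tuple is at most its sum, so the tuple is among those over which the maximum is
-- taken.
packing≤G : ∀ H t x → packingValue H t (map x (primesBelow t)) ≤ℚ G H t (sum (map x (primesBelow t)))
packing≤G H t x = All.lookup (Extremaℚ.xs≤max 0ℚ _) (∈-map⁺ (packingValue H t)
  (∈-filter⁺ (λ y → sum y ≟ sum w)
    (subst (λ n → w ∈ words n (upTo (suc (sum w)))) (length-map x (primesBelow t))
      (∈-words (All.map (∈-upTo⁺ ∘ s≤s) (all≤sum w)))) refl))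
  where
  w = map x (primesBelow t)

-- Insertions

-- Stated through exponents, so that H and H′ can be replaced by g ⊛ ps while
-- g stays a variable.
IsGcd : ℕ → ℕ → ℕ → Set
IsGcd g H H′ = ∀ {q} → Prime q → v q g ≡ v q H ⊓ v q H′

-- The value is the same for every bound B above all entries of `ps`: B = t gives the size of a
-- packing, B = suc (H ⊔ H′) gives `L⁺` or, with the roles exchanged, `L⁻`.
sum-excess : ∀ g .{{_ : NonZero g}} {ps} → All Prime ps → ∀ H → IsGcd g H (g ⊛ ps) →
  ∀ B → All (_< B) ps → sum (map (λ q → v q (g ⊛ ps) ∸ v q H) (primesBelow B)) ≡ length ps
sum-excess g pps H v-g B ps<B = sum-v-∸ (primesBelow-unique B) (primesBelow-prime B) g
  (All.zipWith (λ (pp , p<B) → ∈-primesBelow⁺ pp p<B) (pps , ps<B)) H v-g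

⊛-members≤ : ∀ g .{{_ : NonZero g}} {ps} → All Prime ps → All (_≤ g ⊛ ps) ps
⊛-members≤ g pps = All.tabulate (λ p∈ → ∣⇒≤ {{⊛≢0 g pps}} (m*n∣⇒n∣ g _ (n*p∣n⊛ g p∈)))

members<1+⊔ : ∀ g .{{_ : NonZero g}} {ps} → All Prime ps → ∀ n → All (_< suc (n ⊔ (g ⊛ ps))) ps
members<1+⊔ g {ps} pps n = All.map (λ le → s≤s (≤-trans le (m≤n⊔m n (g ⊛ ps)))) (⊛-members≤ g pps)

insertions-below⇒d≤d : ∀ g .{{_ : NonZero g}} {ps} → All Prime ps → ∀ H .{{_ : NonZero H}} t →
  IsGcd g H (g ⊛ ps) → (∀ {q} → Prime q → q < t → v q H ≡ v q g) → All (_< t) ps →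
  (+ d g / d H) {{d-nonZero H}} *ℚ G H t (L⁺ H (g ⊛ ps)) ≤ℚ 1ℚ → d (g ⊛ ps) ≤ d H
insertions-below⇒d≤d g {ps} pps H t v-g v-below ps<t δG≤1 =
  *-cancelʳ-≤ (d H′) (d H) D {{D≢0}} (subst (_≤ d H * D) eq dgN≤dHD)
  where
  H′ = g ⊛ ps
  qs = primesBelow t
  x = λ q → v q H′ ∸ v q H
  N = product (map (λ q → v q H + x q + 1) qs)
  D = product (map (λ q → suc (v q H)) qs)
  D≢0 : NonZero D
  D≢0 = product-suc≢0 (λ q → v q H) qs
  -- The packing sees only primes below t, `L⁺` all primes up to H ⊔ H′; both sums count the entries
  -- of `ps`.
  sum≡L⁺ : sum (map x qs) ≡ L⁺ H H′
  sum≡L⁺ = trans (sum-excess g pps H v-g t ps<t)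
    (sym (sum-excess g pps H v-g (suc (H ⊔ H′)) (members<1+⊔ g pps H)))
  dgN≤dHD : d g * N ≤ d H * D
  dgN≤dHD = /*≤1⇒*≤* (d g) (d H) N D {{d-nonZero H}} {{D≢0}} {packingValue H t (map x qs)} {G H t (L⁺ H H′)} (foldr-*-/ (λ q → v q H) x qs)
    (subst (λ m → packingValue H t (map x qs) ≤ℚ G H t m) sum≡L⁺ (packing≤G H t x)) δG≤1
  below : ∀ {q} → q ∈ qs → v q H ≡ v q g
  below q∈ = v-below (All.lookup (primesBelow-prime t) q∈) (∈-primesBelow⁻ q∈)
  -- Below t the exponents of H and g agree, and g ∣ H′, so the truncated subtraction in `x` is
  -- exact.
  N≡ : N ≡ product (map (λ q → suc (v q H′)) qs)
  N≡ = cong product (map-cong-local (All.tabulate λ {q} q∈ → trans (+-comm _ 1) (cong suc (m+[n∸m]≡n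
    (subst (_≤ v q H′) (sym (below q∈)) (v-mono-∣ (All.lookup (primesBelow-prime t) q∈) g H′ {{⊛≢0 g pps}} (n∣n⊛ g ps)))))))
  D≡ : D ≡ product (map (λ q → suc (v q g)) qs)
  D≡ = cong product (map-cong-local (All.tabulate (cong suc ∘ below)))
  eq : d g * N ≡ d H′ * D
  eq = trans (cong (d g *_) N≡) (trans (sym (d-⊛ (primesBelow-unique t) (primesBelow-prime t) g
    (All.zipWith (λ (pp , p<t) → ∈-primesBelow⁺ pp p<t) (pps , ps<t)))) (cong (d H′ *_) (sym D≡)))

-- An inserted prime divides H′, so the search up to H′ is exhaustive, and its decidability turns
-- the contradiction into a witness.
large-insertion : ∀ g .{{_ : NonZero g}} {H′ ps} → All Prime ps → H′ ≡ g ⊛ ps → ∀ H .{{_ : NonZero H}} t →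
  IsGcd g H H′ → (∀ {q} → Prime q → q < t → v q H ≡ v q g) → d H < d H′ →
  (+ d g / d H) {{d-nonZero H}} *ℚ G H t (L⁺ H H′) ≤ℚ 1ℚ →
  ∃[ q ] Prime q × t ≤ q × v q H < v q H′
large-insertion g {H′} {ps} pps refl H t v-g v-below dH<dH′ δG≤1 =
  search (anyUpTo? (λ q → prime? q ×-dec t ≤? q ×-dec v q H <? v q H′) (suc H′))
  where
  Large : ℕ → Set
  Large q = Prime q × t ≤ q × v q H < v q H′
  -- If t ≤ p and p is not inserted, then v p H′ ≤ v p H, so v p g = v p H′; but p ∈ ps forces v p g
  -- < v p H′.
  ps<t : ¬ (∃[ q ] q < suc H′ × Large q) → ∀ {p} → p ∈ ps → p < t
  ps<t none {p} p∈ = ≰⇒> λ t≤p → <⇒≢ (v-⊛-∈ g pps p∈) (trans (v-g pp) (m≥n⇒m⊓n≡n (≮⇒≥ λ lt →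
    none (p , s≤s (All.lookup (⊛-members≤ g pps) p∈) , pp , t≤p , lt))))
    where pp = All.lookup pps p∈
  search : Dec (∃[ q ] q < suc H′ × Large q) → ∃[ q ] Large q
  search (yes (q , _ , large)) = q , large
  search (no none) = contradiction (insertions-below⇒d≤d g pps H t v-g v-below (All.tabulate (ps<t none)) δG≤1) (<⇒≱ dH<dH′)

-- Geodesics

d-≤-*-prime : ∀ n .{{_ : NonZero n}} {p} → Prime p → d n ≤ d (n * p)
d-≤-*-prime n {p} pp = *-cancelʳ-≤ (d n) (d (n * p)) (suc (suc (v p n)))
  (≤-trans (≤-reflexive (d-*-prime pp n)) (*-monoʳ-≤ (d (n * p)) (n≤1+n (suc (v p n)))))

d-≤-⊛ : ∀ n .{{_ : NonZero n}} {ps} → All Prime ps → d n ≤ d (n ⊛ ps)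
d-≤-⊛ n []                  = ≤-refl
d-≤-⊛ n {p ∷ ps} (pp ∷ pps) = ≤-trans (d-≤-*-prime n pp) (d-≤-⊛ (n * p) {{n*p≢0 n pp}} pps)

-- The ratio (a + 2) / (a + 1), with a = v p n, is at most 2. This is where the constant ½ comes
-- from.
d-*-prime-≤ : ∀ n .{{_ : NonZero n}} {p} → Prime p → d (n * p) ≤ 2 * d n
d-*-prime-≤ n {p} pp = *-cancelʳ-≤ (d (n * p)) (2 * d n) (suc (v p n)) (begin
  d (n * p) * suc (v p n)    ≡⟨ d-*-prime pp n ⟨
  d n * suc (suc (v p n))    ≤⟨ *-monoʳ-≤ (d n) (s≤s (s≤s (m≤m+n (v p n) (v p n)))) ⟩
  d n * suc (suc (v p n + v p n)) ≡⟨ rearrange (d n) (v p n) ⟩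
  2 * d n * suc (v p n)      ∎)
  where
  open ≤-Reasoning
  rearrange : ∀ x a → x * suc (suc (a + a)) ≡ 2 * x * suc a
  rearrange = solve-∀

step-insert : ∀ {H′} z .{{_ : NonZero z}} {r} → Prime r → v r z < v r H′ → Step H′ z (z * r)
step-insert z {r} pr lt = r , pr , inj₁ (lt , v-*-same pr z) , λ q pq q≢r → v-*-other pr pq q≢r z

step-delete : ∀ {H′} z .{{_ : NonZero z}} {r} → Prime r → v r H′ ≤ v r z → Step H′ (z * r) z
step-delete {H′} z {r} pr le = r , pr , inj₂ (subst (v r H′ <_) (sym (v-*-same pr z)) (s≤s le) , v-*-same pr z) ,
  λ q pq q≢r → sym (v-*-other pr pq q≢r z)

-- With D = d H, the third condition is the bound ½ without division. The number n of vertices is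
-- recorded because `admissibleGeodesics` lists only words of one fixed length.
Route : ℕ → ℕ → ℕ → ℕ → Set
Route D H′ z n = ∃[ γ ] Geodesic z H′ γ × Admissible H′ γ × All (λ w → D ≤ 2 * d w) γ × length γ ≡ n

route-end : ∀ {D} H′ .{{_ : NonZero H′}} → D ≤ 2 * d H′ → Route D H′ H′ 1
route-end H′@(suc _) D≤ = H′ ∷ [] , record { start = refl ; end = refl ; positive = _ ∷ [] ; steps = [-] } , ≤-refl ∷ [] , D≤ ∷ [] , refl

route-step : ∀ {D H′} z .{{_ : NonZero z}} {w n} → Step H′ z w → z ≤ H′ → D ≤ 2 * d z → Route D H′ w n → Route D H′ z (suc n)
route-step z step z≤ D≤ ([] , γ-geo , _) = contradiction (Geodesic.start γ-geo) λ ()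
route-step {H′ = H′} z@(suc _) step z≤ D≤ (w ∷ ws , γ-geo , γ≤ , γD , len) =
  z ∷ w ∷ ws , record { start = refl ; end = end ; positive = _ ∷ positive
                      ; steps = subst (Step H′ z) (sym (just-injective start)) step ∷ steps } ,
  z≤ ∷ γ≤ , D≤ ∷ γD , cong suc len
  where open Geodesic γ-geo

½≤βgeo : ∀ H H′ .{{_ : NonZero H}} → Route (d H) H′ H (suc (L⁻ H H′ + L⁺ H H′)) → ½ ≤ℚ βgeo H H′
½≤βgeo H H′ ([] , γ-geo , _) = contradiction (Geodesic.start γ-geo) λ ()
½≤βgeo H H′ (γ@(z ∷ zs) , γ-geo , γ≤ , Dz ∷ Dzs , len) = ≤2*⇒½≤/ (max 0 (map minDivisors (admissibleGeodesics H H′))) (d H) {{d-nonZero H}}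
  (≤-trans (argmin-all id {P = λ x → d H ≤ 2 * x} Dz (All.map⁺ Dzs))
    (*-monoʳ-≤ 2 (All.lookup (xs≤max 0 _) (∈-map⁺ minDivisors γ∈))))
  where
  γ∈ : γ ∈ admissibleGeodesics H H′
  γ∈ = ∈-filter⁺ (λ γ → geodesic? H H′ γ ×-dec All.all? (_≤? H′) γ)
    (subst (λ n → γ ∈ words n (upTo (suc H′))) len (∈-words (All.map (∈-upTo⁺ ∘ s≤s) γ≤))) (γ-geo , γ≤)

-- The factor t, still to be deleted, is carried along, so the current vertex is a * t. Each vertex
-- divides the last one, so the bound by H′ is needed only there; d grows along insertions, so the
-- lower bound is needed only at the start.
route-insert : ∀ {D H′ n t} .{{_ : NonZero H′}} → Prime t → ∀ a .{{_ : NonZero a}} {rs} → All Prime rs → t ∉ rs →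
  a ⊛ rs ∣ H′ → (a ⊛ rs) * t ≤ H′ → D ≤ 2 * d (a * t) → Route D H′ ((a ⊛ rs) * t) n → Route D H′ (a * t) (length rs + n)
route-insert pt a [] t∉ a∣ le D≤ ρ = ρ
route-insert {D} {H′} {n} {t} pt a {r ∷ rs} (pr ∷ prs) t∉ a∣ le D≤ ρ =
  route-step (a * t) (subst (Step H′ (a * t)) (xy∙z≈xz∙y a t r) (step-insert {H′} (a * t) pr lt)) at≤ D≤
    (route-insert pt (a * r) prs (t∉ ∘ there) a∣ le D≤′ ρ)
  where
  instance
    _ = n*p≢0 a pt
    _ = n*p≢0 a pr
    _ = n*p≢0 (a * r ⊛ rs) {{⊛≢0 (a * r) prs}} pt
  -- As r ≠ t, the exponent of r is that in a, and a * r still divides H′.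
  lt : v r (a * t) < v r H′
  lt = subst₂ _≤_ (trans (v-*-same pr a) (cong suc (sym (v-*-other pt pr (t∉ ∘ here ∘ sym) a)))) refl
    (v-mono-∣ pr (a * r) H′ (∣-trans (n∣n⊛ (a * r) rs) a∣))
  at≤ : a * t ≤ H′
  at≤ = ≤-trans (∣⇒≤ (*-monoˡ-∣ t (n∣n⊛ a (r ∷ rs)))) le
  D≤′ : D ≤ 2 * d (a * r * t)
  D≤′ = subst (λ z → D ≤ 2 * d z) (xy∙z≈xz∙y a t r) (≤-trans D≤ (*-monoʳ-≤ 2 (d-≤-*-prime (a * t) pr)))

route : ∀ g .{{_ : NonZero g}} {t s q rs} → Prime t → Prime s → Prime q → All Prime rs →
  let H = g * t * s ; H′ = g ⊛ (q ∷ rs) in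
  H ≤ H′ → d H ≤ d H′ → t < q → v t H′ ≤ v t g → v s H′ ≤ v s g → Route (d H) H′ H (suc (2 + suc (length rs)))
route g {t} {s} {q} {rs} pt ps pq prs H≤H′ dH≤dH′ t<q vt≤ vs≤ =
  route-step (g * t * s) (step-delete {H′} (g * t) ps (≤-trans vs≤ (v-mono-∣ ps g (g * t) (m∣m*n t)))) H≤H′ (m≤m+n (d H) _)
    -- The 3 counts the last vertices (g ⊛ rs) * t, g ⊛ rs and H′.
    (subst (Route (d H) H′ (g * t)) (+-comm (length rs) 3)
      (route-insert pt g prs t∉ gR∣ gRt≤ (d-*-prime-≤ (g * t) ps)
        (route-step ((g ⊛ rs) * t) (step-delete {H′} (g ⊛ rs) pt (≤-trans vt≤ (v-mono-∣ pt g (g ⊛ rs) (n∣n⊛ g rs)))) gRt≤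
            -- The vertex (g ⊛ rs) * t is a multiple of g * t = H / s.
            (≤-trans (d-*-prime-≤ (g * t) ps) (*-monoʳ-≤ 2 (subst (λ z → d (g * t) ≤ d z) (⊛-*-comm g t rs) (d-≤-⊛ (g * t) prs))))
          (route-step (g ⊛ rs) (subst (Step H′ (g ⊛ rs)) (sym H′≡) (step-insert {H′} (g ⊛ rs) pq vq<)) (∣⇒≤ gR∣)
              -- The vertex g ⊛ rs is H′ / q, whence d H ≤ d H′ ≤ 2 * d (H′ / q).
              (≤-trans dH≤dH′ (subst (λ z → d z ≤ 2 * d (g ⊛ rs)) (sym H′≡) (d-*-prime-≤ (g ⊛ rs) pq)))
            (route-end H′ (m≤n⇒m≤n+o _ dH≤dH′))))))
  where
  H = g * t * s
  H′ = g ⊛ (q ∷ rs)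
  H′≡ : H′ ≡ (g ⊛ rs) * q
  H′≡ = ⊛-*-comm g q rs
  instance
    _ = n*p≢0 g pt
    _ = n*p≢0 (g * t) ps
    _ = ⊛≢0 g prs
    _ = ⊛≢0 g (pq ∷ prs)
    _ = n*p≢0 (g ⊛ rs) pt
  t∉ : t ∉ rs
  t∉ t∈ = <⇒≱ (v-⊛-∈ g (pq ∷ prs) (there t∈)) vt≤
  gR∣ : g ⊛ rs ∣ H′
  gR∣ = divides q (trans H′≡ (*-comm (g ⊛ rs) q))
  vq< : v q (g ⊛ rs) < v q H′
  vq< = ≤-reflexive (trans (sym (v-*-same pq (g ⊛ rs))) (cong (v q) (sym H′≡)))
  gRt≤ : (g ⊛ rs) * t ≤ H′
  gRt≤ = subst ((g ⊛ rs) * t ≤_) (sym H′≡) (*-monoʳ-≤ (g ⊛ rs) (<⇒≤ t<q))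

-- Deletions

-- A layer gives v p g ≤ v p H′ < j ≤ v p (g ⊛ ps), so p must be among the primes that lead from g
-- to g ⊛ ps.
deletion⇒∈ : ∀ {g ps H′ p j} .{{_ : NonZero g}} → All Prime ps → (∀ {q} → Prime q → v q g ≤ v q H′) →
  DeletionLayer (g ⊛ ps) H′ p j → p ∈ ps
deletion⇒∈ {g} {ps} pps v≤ ℓ = v-⊛-<⇒∈ base g {ps} pps (≤-trans (s≤s (v≤ base)) (≤-trans above upto))
  where open DeletionLayer ℓ

-- Layers over distinct primes account for x and y in some order. Two layers over one prime p make
-- its exponent rise by two from g to g * x * y, which forces x = y = p.
pivot⇒factors : ∀ {g x y H′ t} .{{_ : NonZero g}} → Prime x → Prime y → (∀ {q} → Prime q → v q g ≤ v q H′) →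
  Pivot (g * x * y) H′ t → ∃[ s ] Prime t × Prime s × t ≤ s × g * x * y ≡ g * t * s
pivot⇒factors {g} {x} {y} px py v≤ (distinct ℓ₁ ℓ₂ p<q)
  with deletion⇒∈ (px ∷ py ∷ []) v≤ ℓ₁ | deletion⇒∈ (px ∷ py ∷ []) v≤ ℓ₂
... | here refl         | here refl         = contradiction p<q (n≮n _)
... | here refl         | there (here refl) = y , px , py , <⇒≤ p<q , refl
... | there (here refl) | here refl         = x , py , px , <⇒≤ p<q , xy∙z≈xz∙y g x y
... | there (here refl) | there (here refl) = contradiction p<q (n≮n _)
pivot⇒factors {g} {x} {y} {H′} px py v≤ (single {p} {j} {k} ℓ₁ ℓ₂ j<k) = p , pp , pp , ≤-refl , cong₂ (λ a b → g * a * b) x≡p y≡p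
  where
  pp = DeletionLayer.base ℓ₁
  instance _ = n*p≢0 g px
  drop-two : suc (suc (v p g)) ≤ v p (g * x * y)
  drop-two = ≤-trans (s≤s (≤-trans (s≤s (v≤ pp)) (DeletionLayer.above ℓ₁))) (≤-trans j<k (DeletionLayer.upto ℓ₂))
  v-*-≤ : ∀ {r} → Prime r → ∀ n .{{_ : NonZero n}} → v p (n * r) ≤ suc (v p n)
  v-*-≤ {r} pr n with p ≟ r
  ... | yes refl = ≤-reflexive (v-*-same pp n)
  ... | no  p≢r  = ≤-trans (≤-reflexive (v-*-other pr pp p≢r n)) (n≤1+n _)
  y≡p : y ≡ p
  y≡p with p ≟ y
  ... | yes p≡y = sym p≡y
  ... | no  p≢y = contradiction (≤-trans drop-two (≤-trans (≤-reflexive (v-*-other py pp p≢y (g * x))) (v-*-≤ px g))) 1+n≰n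
  x≡p : x ≡ p
  x≡p with p ≟ x
  ... | yes p≡x = sym p≡x
  ... | no  p≢x = contradiction (≤-trans drop-two (≤-trans (v-*-≤ py (g * x)) (s≤s (≤-reflexive (v-*-other px pp p≢x g))))) 1+n≰n

-- `L⁻` counts the entries of `ps`, so there are exactly two of them, and the pivot tells which is
-- t.
two-deletions : ∀ {g H H′ t ps} .{{_ : NonZero g}} → All Prime ps → H ≡ g ⊛ ps → IsGcd g H H′ → L⁻ H H′ ≡ 2 →
  Pivot H H′ t → ∃[ s ] Prime t × Prime s × t ≤ s × H ≡ g * t * s
two-deletions {g} {H} {H′} {t} {ps} pps refl v-g L⁻≡2 = factors pps (trans (sym length≡) L⁻≡2)
  where
  length≡ : L⁻ (g ⊛ ps) H′ ≡ length ps
  length≡ = sum-excess g pps H′ (λ {q} pq → trans (v-g pq) (⊓-comm (v q H) (v q H′))) (suc (H ⊔ H′))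
    (subst (λ n → All (_< suc n) ps) (⊔-comm H′ H) (members<1+⊔ g pps H′))
  v≤ : ∀ {q} → Prime q → v q g ≤ v q H′
  v≤ {q} pq = ≤-trans (≤-reflexive (v-g pq)) (m⊓n≤n (v q H) (v q H′))
  factors : ∀ {ps} → All Prime ps → length ps ≡ 2 → Pivot (g ⊛ ps) H′ t →
    ∃[ s ] Prime t × Prime s × t ≤ s × g ⊛ ps ≡ g * t * s
  factors (px ∷ py ∷ []) refl = pivot⇒factors px py v≤

-- Applied with c, a, b the exponents of a prime in g, H, H′: if the prime is deleted, the minimum
-- is attained at H′.
⊓-<⇒≤ : ∀ {a b c : ℕ} → c ≡ a ⊓ b → c < a → b ≤ c
⊓-<⇒≤ {a} {b} refl c<a = [ (λ a≤b → contradiction (m≤n⇒m⊓n≡m a≤b) (<⇒≢ c<a)) , ≤-reflexive ∘ sym ∘ m≥n⇒m⊓n≡n ]′ (≤-total a b)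

-- Since q is among the primes leading from g to H′, g * q divides H′; factorising H′ / (g * q) puts
-- q at the head of the list.
insertion⇒≡⊛ : ∀ {g H′ q} .{{_ : NonZero g}} .{{_ : NonZero H′}} → Prime q → g ∣ H′ → v q g < v q H′ →
  ∃[ rs ] All Prime rs × H′ ≡ g ⊛ (q ∷ rs)
insertion⇒≡⊛ {g} {H′} {q} pq g∣H′ vq< = ∣⇒≡⊛ g*q∣H′
  where
  added : ∃[ ps ] All Prime ps × H′ ≡ g ⊛ ps
  added = ∣⇒≡⊛ g∣H′
  pps = proj₁ (proj₂ added)
  H′≡ = proj₂ (proj₂ added)
  g*q∣H′ : g * q ∣ H′
  g*q∣H′ = subst (g * q ∣_) (sym H′≡) (n*p∣n⊛ g (v-⊛-<⇒∈ pq g pps (subst (λ n → v q g < v q n) H′≡ vq<)))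

capacity≥½ : ∀ g {H H′ t s q rs} .{{_ : NonZero g}} .{{_ : NonZero H}} → Prime t → Prime s → Prime q → All Prime rs →
  H ≡ g * t * s → H′ ≡ g ⊛ (q ∷ rs) → IsGcd g H H′ → L⁻ H H′ ≡ 2 → H ≤ H′ → d H ≤ d H′ → t < q → ½ ≤ℚ βgeo H H′
capacity≥½ g {H} {H′} {t} {s} {q} {rs} pt ps pq prs refl refl v-g L⁻≡2 H≤H′ dH≤dH′ t<q =
  ½≤βgeo H H′ (subst (Route (d H) H′ H) (cong₂ (λ a b → suc (a + b)) (sym L⁻≡2) (sym length≡))
    (route g pt ps pq prs H≤H′ dH≤dH′ t<q (kept pt (here refl)) (kept ps (there (here refl)))))
  where
  length≡ : L⁺ H H′ ≡ suc (length rs)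
  length≡ = sum-excess g (pq ∷ prs) H v-g (suc (H ⊔ H′)) (members<1+⊔ g (pq ∷ prs) H)
  kept : ∀ {p} → Prime p → p ∈ t ∷ s ∷ [] → v p H′ ≤ v p g
  kept pp p∈ = ⊓-<⇒≤ (v-g pp) (v-⊛-∈ g (pt ∷ ps ∷ []) p∈)

theorem6p4 : (H H' : ℕ) .{{_ : NonZero H}} → Consecutive H H' → L⁻ H H' ≡ 2 →
    (t : ℕ) → Pivot H H' t →
    let g = gcd H H'
        δ = (+ d g / d H) {{d-nonZero H}}
        m = L⁺ H H'
    in δ *ℚ G H t m ≤ℚ 1ℚ →
       (∃[ q ] Prime q × t ≤ q × v q H < v q H') × ½ ≤ℚ βgeo H H'
theorem6p4 H H' consecutive L⁻≡2 t pivot δG≤1 = conclude deletions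
  where
  open Consecutive consecutive
  g = gcd H H'
  instance
    _ : NonZero H'
    _ = proj₁ highlyComposite′
    _ : NonZero g
    _ = ≢-nonZero (gcd[m,n]≢0 H H' (inj₁ (≢-nonZero⁻¹ H)))
  dH<dH' : d H < d H'
  dH<dH' = proj₂ highlyComposite′ H (>-nonZero⁻¹ H) ordered
  v-g : IsGcd g H H'
  v-g pq = v-gcd pq H H'
  removed : ∃[ ps ] All Prime ps × H ≡ g ⊛ ps
  removed = ∣⇒≡⊛ (gcd[m,n]∣m H H')
  added : ∃[ ps ] All Prime ps × H' ≡ g ⊛ ps
  added = ∣⇒≡⊛ (gcd[m,n]∣n H H')
  deletions : ∃[ s ] Prime t × Prime s × t ≤ s × H ≡ g * t * s
  deletions = two-deletions (proj₁ (proj₂ removed)) (proj₂ (proj₂ removed)) v-g L⁻≡2 pivot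
  conclude : (∃[ s ] Prime t × Prime s × t ≤ s × H ≡ g * t * s) →
    (∃[ q ] Prime q × t ≤ q × v q H < v q H') × ½ ≤ℚ βgeo H H'
  conclude (s , pt , ps , t≤s , H≡) = insertion , capacity insertion
    where
    -- A prime below t is neither t nor s, so passing from g to H leaves its exponent alone.
    below : ∀ {q} → Prime q → q < t → v q H ≡ v q g
    below {q} pq q<t = trans (cong (v q) H≡) (v-⊛-∉ pq g (pt ∷ ps ∷ []) λ where
      (here refl)         → n≮n q q<t
      (there (here refl)) → <⇒≱ q<t t≤s)
    insertion : ∃[ q ] Prime q × t ≤ q × v q H < v q H'
    insertion = large-insertion g (proj₁ (proj₂ added)) (proj₂ (proj₂ added)) H t v-g below dH<dH' δG≤1
    capacity : (∃[ q ] Prime q × t ≤ q × v q H < v q H') → ½ ≤ℚ βgeo H H'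
    capacity (q , pq , t≤q , vq<) = capacity≥½ g pt ps pq (proj₁ (proj₂ split)) H≡ (proj₂ (proj₂ split)) v-g L⁻≡2
        (<⇒≤ ordered) (<⇒≤ dH<dH') (≤∧≢⇒< t≤q t≢q)
      where
      split : ∃[ rs ] All Prime rs × H' ≡ g ⊛ (q ∷ rs)
      split = insertion⇒≡⊛ pq (gcd[m,n]∣n H H') (≤-<-trans (v-mono-∣ pq g H (gcd[m,n]∣m H H')) vq<)
      -- Since t is deleted, v t H' ≤ v t g ≤ v t H, whereas q is inserted.
      t≢q : t ≢ q
      t≢q refl = <⇒≱ vq< (≤-trans (⊓-<⇒≤ (v-g pt) (subst (λ n → v t g < v t n) (sym H≡) (v-⊛-∈ g (pt ∷ ps ∷ []) (here refl))))
        (v-mono-∣ pt g H (gcd[m,n]∣m H H')))
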